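{- Let $r \geq 2$ and $n \geq 1$ be integers, and let $\Gamma$ be an unbalanced signed graph on $n$ vertices that is $\mathcal{K}^-_{r+1}$-free, i.e., $\Gamma$ contains no unbalanced signed complete graph on $r+1$ vertices as a (signed) subgraph. Then the number of edges of $\Gamma$ satisfies $$e(\Gamma) \leq \frac{n(n-1)}{2} - (n - r).$$
   Context: A signed graph $\Gamma=(G,\sigma)$ is a simple graph $G$ (the underlying graph) together with a sign function $\sigma: E(G)\to\{ -1,+1\}$. A cycle is positive if it contains an even number of negative edges and negative otherwise; $\Gamma$ is balanced if all its cycles are positive and unbalanced otherwise. $\mathcal{K}^-_{k}$ denotes the set of unbalanced signed complete graphs on $k$ vertices (signed graphs whose underlying graph is $K_k$ and which are unbalanced), and $\Gamma$ is $\mathcal{K}^-_{k}$-free if no subgraph of $\Gamma$, with the inherited signs, belongs to $\mathcal{K}^-_{k}$. $e(\Gamma)$ denotes the number of edges of $\Gamma$. -}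

module Defs where

open import Data.Fin using (Fin; _<?_)
open import Data.List using (List; []; _∷_; length; filter; allFin; cartesianProduct)
open import Data.List.Relation.Unary.Unique.Propositional using (Unique)
open import Data.Nat using (ℕ; suc; _≤_)
open import Data.Nat.Divisibility using (_∣_)
open import Data.Product using (_×_; _,_)
open import Data.Sign using (Sign)
open import Function.Definitions using (Injective)
open import Level using (0ℓ)
open import Relation.Binary.Construct.Closure.ReflexiveTransitive using (Star; ε; _◅_)
open import Relation.Binary.Core using (Rel)
open import Relation.Binary.Definitions using (Decidable; Irreflexive; Symmetric)
open import Relation.Binary.PropositionalEquality using (_≡_; _≢_)
open import Relation.Nullary using (¬_)
open import Relation.Nullary.Decidable using (_×-dec_)

record SimpleGraph (n : ℕ) : Set₁ where
  field
    Adj     : Rel (Fin n) 0ℓ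
    adj?    : Decidable Adj
    symm    : Symmetric Adj
    irrefl  : Irreflexive _≡_ Adj

record SignedGraph (n : ℕ) : Set₁ where
  field
    graph : SimpleGraph n
  open SimpleGraph graph public
  field
    σ     : ∀ {u v} → Adj u v → Sign
    -- σ is a function of the unordered pair {u , v}. Since the second proof is
    -- arbitrary, and Adj is symmetric, this also makes σ independent of the
    -- proof of adjacency.
    σ-sym : ∀ {u v} (a : Adj u v) (b : Adj v u) → σ a ≡ σ b

module _ {n : ℕ} (Γ : SignedGraph n) where
  open SignedGraph Γ

  -- Each edge is counted once, as the pair (u , v) with u < v.
  e : ℕ
  e = length (filter (λ (u , v) → (u <? v) ×-dec adj? u v)
                     (cartesianProduct (allFin n) (allFin n)))

  Walk : Rel (Fin n) 0ℓ
  Walk = Star Adj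

  -- All vertices visited by a walk except the final one; there is one entry
  -- per edge.
  sources : ∀ {u v} → Walk u v → List (Fin n)
  sources ε               = []
  sources (_◅_ {i = u} _ w) = u ∷ sources w

  IsCycle : ∀ {u} → Walk u u → Set
  IsCycle w = 3 ≤ length (sources w) × Unique (sources w)

  negativeEdges : ∀ {u v} → Walk u v → ℕ
  negativeEdges ε       = 0
  negativeEdges (a ◅ w) with σ a
  ... | Sign.- = suc (negativeEdges w)
  ... | Sign.+ = negativeEdges w

  Positive : ∀ {u} → Walk u u → Set
  Positive w = 2 ∣ negativeEdges w

  Balanced : Set
  Balanced = ∀ {u} (w : Walk u u) → IsCycle w → Positive w

  Unbalanced : Set
  Unbalanced = ¬ Balanced

  Complete : Set
  Complete = ∀ {u v} → u ≢ v → Adj u v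

-- Δ ⊑ Γ: Δ is isomorphic to a (not necessarily induced) subgraph of Γ with
-- the inherited signs.
record _⊑_ {k n : ℕ} (Δ : SignedGraph k) (Γ : SignedGraph n) : Set where
  private
    module Δ = SignedGraph Δ
    module Γ = SignedGraph Γ
  field
    vertex    : Fin k → Fin n
    injective : Injective _≡_ _≡_ vertex
    edge      : ∀ {u v} → Δ.Adj u v → Γ.Adj (vertex u) (vertex v)
    sign      : ∀ {u v} (a : Δ.Adj u v) → Γ.σ (edge a) ≡ Δ.σ a

𝒦⁻ : (k : ℕ) → SignedGraph k → Set
𝒦⁻ k Δ = Complete Δ × Unbalanced Δ

𝒦⁻-Free : (k : ℕ) {n : ℕ} → SignedGraph n → Set₁
𝒦⁻-Free k Γ = (Δ : SignedGraph k) → 𝒦⁻ k Δ → ¬ (Δ ⊑ Γ)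

{-# OPTIONS --safe #-}
-- Grow a spanning forest of the complement of Γ: a new vertex with a
-- non-neighbour among the earlier ones contributes a missing edge, and otherwise
-- it is a root. With k roots at least n − k edges are missing, so it suffices to
-- find a forest with at most r roots.
--
-- The roots of such a forest form a clique. If Γ has a negative triangle, start
-- from its three vertices as roots: the clique of roots is then always unbalanced,
-- hence never has more than r vertices. If Γ has no negative triangle, only open
-- a new root when the current component of the complement is exhausted. A third
-- root would make Γ a join of three nonempty parts, and a join of three parts
-- without negative triangles has a switching function, hence is balanced; so
-- 2 ≤ r roots suffice.
module Submission where

open import Defs
open import Data.Nat using (ℕ; suc; _≤_; _*_; _∸_)
open import Data.Nat.DivMod using (_/_)
open import Data.Integer using (+_; _-_) renaming (_≤_ to _≤ᶻ_)

open import Algebra.Properties.Group using (x∙y⁻¹≈ε⇒x≈y)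
open import Data.Bool using (if_then_else_)
open import Data.Empty using (⊥-elim)
open import Data.Fin using (Fin; zero; suc; _<_; _<?_; fromℕ<)
open import Data.Fin.Properties using (_≟_; any?; injective⇒≤; <-asym)
import Data.Integer as ℤ
import Data.Integer.Properties as ℤ
open import Data.Integer.Solver using (module +-*-Solver)
open import Data.List
  using (List; []; _∷_; _++_; length; filter; map; lookup; allFin; cartesianProduct)
open import Data.List.Membership.Propositional using (_∈_; _∉_)
open import Data.List.Membership.Propositional.Properties
  using (∈-lookup; ∈-allFin; ∈-++⁺ˡ; ∈-++⁺ʳ; ∈-map⁺; ∈-filter⁺; ∈-filter⁻)
open import Data.List.Properties
  using (length-++; length-map; length-filter; filter-notAll; length-tabulate)
open import Data.List.Relation.Binary.Subset.Propositional using (_⊆_)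
open import Data.List.Relation.Unary.All as All using (All; []; _∷_; all?)
open import Data.List.Relation.Unary.All.Properties using (¬Any⇒All¬; ¬All⇒Any¬)
open import Data.List.Relation.Unary.AllPairs using (AllPairs; []; _∷_)
open import Data.List.Relation.Unary.Any using (here; there; index)
open import Data.List.Relation.Unary.Any.Properties using (lookup-index)
open import Data.List.Relation.Unary.Unique.Propositional using (Unique)
open import Data.List.Relation.Unary.Unique.Propositional.Properties
  using (allFin⁺; filter⁺; cartesianProduct⁺)
open import Data.Nat using (zero; _+_; z≤n; s≤s)
open import Data.Nat.Divisibility using (_∣_; divides; n∣m*n)
open import Data.Nat.DivMod using (m*n/n≡m; /-monoˡ-≤; +-distrib-/-∣ʳ)
import Data.Nat.Base as ℕ
import Data.Nat.Properties as ℕ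
open import Data.Nat.Tactic.RingSolver using (solve-∀)
open import Data.Product using (∃; ∃₂; ∃-syntax; _×_; _,_)
open import Data.Sign using (Sign; opposite) renaming (_*_ to _·_)
open import Data.Sign.Properties as Sign
  using (*-comm; *-assoc; *-identityʳ; s*s≡+; opposite-involutive; *-group)
open import Data.Sum using (_⊎_; inj₁; inj₂)
open import Function using (_∘_; id)
open import Function.Definitions using (Injective)
open import Level using (0ℓ)
open import Relation.Binary.Core using (Rel)
open import Relation.Binary.Definitions using (Symmetric)
open import Relation.Binary.Construct.Closure.ReflexiveTransitive using (ε; _◅_)
open import Relation.Binary.PropositionalEquality
  using (_≡_; _≢_; refl; sym; trans; cong; cong₂; subst; ≢-sym; module ≡-Reasoning)
open import Relation.Nullary using (¬_; Dec; yes; no; contradiction)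
open import Relation.Nullary.Decidable
  using (does; ¬?; _×-dec_; decidable-stable; dec-true; dec-false)
open import Relation.Unary using (Decidable)

private
  variable
    k n r : ℕ

module _ {n : ℕ} where
  open import Data.List.Membership.DecPropositional (_≟_ {n}) public using (_∈?_)

-- Repetition-free lists and their lengths.

allPairs-lookup : ∀ {A : Set} {_~_ : Rel A 0ℓ} {xs} → Symmetric _~_ → AllPairs _~_ xs →
                  ∀ {i j} → i ≢ j → lookup xs i ~ lookup xs j
allPairs-lookup _     (_ ∷ _)  {zero}  {zero}  i≢j = contradiction refl i≢j
allPairs-lookup _     (a ∷ _)  {zero}  {suc j} _   = All.lookup a (∈-lookup j)
allPairs-lookup ~-sym (a ∷ _)  {suc i} {zero}  _   = ~-sym (All.lookup a (∈-lookup i))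
allPairs-lookup ~-sym (_ ∷ as) {suc i} {suc j} i≢j = allPairs-lookup ~-sym as (i≢j ∘ cong suc)

unique-⊆⇒length≤ : ∀ {A : Set} {xs ys : List A} → Unique xs → xs ⊆ ys → length xs ≤ length ys
unique-⊆⇒length≤ {xs = xs} {ys} unique sub = injective⇒≤ {f = position} position-injective
  where
  position : Fin (length xs) → Fin (length ys)
  position i = index (sub (∈-lookup i))

  position-injective : Injective _≡_ _≡_ position
  position-injective {i} {j} eq = decidable-stable (i ≟ j) λ i≢j → allPairs-lookup ≢-sym unique i≢j (begin
    lookup xs i             ≡⟨ lookup-index (sub (∈-lookup i)) ⟩
    lookup ys (position i)  ≡⟨ cong (lookup ys) eq ⟩
    lookup ys (position j)  ≡⟨ lookup-index (sub (∈-lookup j)) ⟨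
    lookup xs j             ∎)
    where open ≡-Reasoning

unique⇒length≤ : {xs : List (Fin n)} → Unique xs → length xs ≤ n
unique⇒length≤ {n} {xs} unique =
  subst (length xs ≤_) (length-tabulate {n = n} id) (unique-⊆⇒length≤ unique λ {x} _ → ∈-allFin x)

covering⇒≤length : {xs : List (Fin n)} → (∀ x → x ∈ xs) → n ≤ length xs
covering⇒≤length {n} {xs} all∈ =
  subst (_≤ length xs) (length-tabulate {n = n} id) (unique-⊆⇒length≤ (allFin⁺ n) λ {x} _ → all∈ x)

∉⇒unique : ∀ {A : Set} {x : A} {xs} → x ∉ xs → Unique xs → Unique (x ∷ xs)
∉⇒unique x∉xs unique = ¬Any⇒All¬ _ x∉xs ∷ unique

∈⇒lookup : ∀ {A : Set} {x : A} {xs} → x ∈ xs → ∃ λ i → lookup xs i ≡ x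
∈⇒lookup x∈xs = index x∈xs , sym (lookup-index x∈xs)

covering-or-missing : (xs : List (Fin n)) → (∀ x → x ∈ xs) ⊎ (∃ λ x → x ∉ xs)
covering-or-missing xs with any? (λ x → ¬? (x ∈? xs))
... | yes missing = inj₂ missing
... | no  none    = inj₁ λ x → decidable-stable (x ∈? xs) (none ∘ (x ,_))

-- Sign algebra and parity.

·-cancelᵐ : ∀ p q r → (p · q) · (q · r) ≡ p · r
·-cancelᵐ p q r = trans (*-assoc p q (q · r)) (cong (p ·_)
  (trans (sym (*-assoc q q r)) (cong (_· r) (s*s≡+ q))))

·-cancelʳ : ∀ p q r → (p · q) · (r · q) ≡ p · r
·-cancelʳ p q r = trans (cong ((p · q) ·_) (*-comm r q)) (·-cancelᵐ p q r)

p·q·q≡p : ∀ p q → (p · q) · q ≡ p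
p·q·q≡p p q = trans (*-assoc p q q) (trans (cong (p ·_) (s*s≡+ q)) (*-identityʳ p))

-1^_ : ℕ → Sign
-1^ zero  = Sign.+
-1^ suc m = opposite (-1^ m)

-1^≡+⇒2∣ : ∀ m → -1^ m ≡ Sign.+ → 2 ∣ m
-1^≡+⇒2∣ zero          _  = divides 0 refl
-1^≡+⇒2∣ (suc (suc m)) eq with -1^≡+⇒2∣ m (trans (sym (opposite-involutive _)) eq)
... | divides q refl = divides (suc q) refl

2∣⇒-1^≡+ : ∀ {m} → 2 ∣ m → -1^ m ≡ Sign.+
2∣⇒-1^≡+ (divides zero    refl) = refl
2∣⇒-1^≡+ (divides (suc q) refl) = trans (opposite-involutive _) (2∣⇒-1^≡+ (divides q refl))

-- Brings an edge into the form in which `e` counts it.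
orient : Fin n → Fin n → Fin n × Fin n
orient u v = if does (u <? v) then (u , v) else (v , u)

orient-< : {u v : Fin n} → u < v → orient u v ≡ (u , v)
orient-< {u = u} {v} u<v rewrite dec-true (u <? v) u<v = refl

orient-> : {u v : Fin n} → u < v → orient v u ≡ (u , v)
orient-> {u = u} {v} u<v rewrite dec-false (v <? u) (<-asym u<v) = refl

-- Criteria for balance, and cliques as signed subgraphs.

module _ (Γ : SignedGraph n) where
  open SignedGraph Γ

  sign-◅ : ∀ {u v w} (a : Adj u v) (p : Walk Γ v w) →
           -1^ negativeEdges Γ (a ◅ p) ≡ σ a · (-1^ negativeEdges Γ p)
  sign-◅ a p with σ a
  ... | Sign.- = refl
  ... | Sign.+ = refl

  -- The sign of a walk telescopes to the product of `s` at its two ends, which is `+` for a closed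
  -- walk.
  switching⇒balanced : (s : Fin n → Sign) → (∀ {u v} (a : Adj u v) → σ a ≡ s u · s v) → Balanced Γ
  switching⇒balanced s σ≡ {u} w _ = -1^≡+⇒2∣ _ (trans (walk-sign w) (s*s≡+ (s u)))
    where
    walk-sign : ∀ {u v} (w : Walk Γ u v) → -1^ negativeEdges Γ w ≡ s u · s v
    walk-sign ε       = sym (s*s≡+ (s _))
    walk-sign (a ◅ w) = trans (sign-◅ a w)
      (trans (cong₂ _·_ (σ≡ a) (walk-sign w)) (·-cancelᵐ (s _) (s _) (s _)))

  negativeTriangle⇒unbalanced : ∀ {x y z} (a : Adj x y) (b : Adj y z) (c : Adj x z) →
                                σ a · σ b ≢ σ c → Unbalanced Γ
  negativeTriangle⇒unbalanced {x} a b c neg balanced =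
    -- Every sign is its own inverse, so the last factor `σ c` serves as the inverse.
    neg (x∙y⁻¹≈ε⇒x≈y *-group _ _ (begin
      (σ a · σ b) · σ c                   ≡⟨ *-assoc (σ a) (σ b) (σ c) ⟩
      σ a · (σ b · σ c)                   ≡⟨ cong (λ s → σ a · (σ b · s)) c-sign ⟩
      σ a · (σ b · -1^ neg# (symm c ◅ ε)) ≡⟨ cong (σ a ·_) (sign-◅ b _) ⟨
      σ a · -1^ neg# (b ◅ symm c ◅ ε)     ≡⟨ sign-◅ a _ ⟨
      -1^ neg# cycle                      ≡⟨ 2∣⇒-1^≡+ (balanced cycle isCycle) ⟩
      Sign.+                              ∎))
    where
    open ≡-Reasoning
    neg# : ∀ {u v} → Walk Γ u v → ℕ
    neg# = negativeEdges Γ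

    cycle : Walk Γ x x
    cycle = a ◅ b ◅ symm c ◅ ε

    isCycle : IsCycle Γ cycle
    isCycle = ℕ.≤-refl , ((λ eq → irrefl eq a) ∷ (λ eq → irrefl eq c) ∷ [])
                       ∷ ((λ eq → irrefl eq b) ∷ []) ∷ [] ∷ []

    c-sign : σ c ≡ -1^ neg# (symm c ◅ ε)
    c-sign = trans (σ-sym c (symm c)) (sym (trans (sign-◅ (symm c) ε) (*-identityʳ _)))

  pullback : (Fin k → Fin n) → SignedGraph k
  pullback f = record
    { graph = record
      { Adj    = λ i j → Adj (f i) (f j)
      ; adj?   = λ i j → adj? (f i) (f j)
      ; symm   = symm
      ; irrefl = λ { refl → irrefl refl }
      }
    ; σ     = σ
    ; σ-sym = σ-sym
    }

  clique⇒complete : ∀ {K} → AllPairs Adj K → Complete (pullback (lookup K))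
  clique⇒complete = allPairs-lookup symm

  clique⇒⊑ : ∀ {K} → AllPairs Adj K → pullback (lookup K) ⊑ Γ
  clique⇒⊑ {K} clique = record
    { vertex    = lookup K
    -- Distinct positions hold adjacent vertices, and adjacency is irreflexive.
    ; injective = λ {i} {j} eq → decidable-stable (i ≟ j) λ i≢j →
                    irrefl eq (clique⇒complete clique i≢j)
    ; edge      = id
    ; sign      = λ _ → refl
    }

module _ (Γ : SignedGraph n) where
  open SignedGraph Γ

  -- σ as a function of the two vertices, with junk value + on non-edges.
  τ : Fin n → Fin n → Sign
  τ u v with adj? u v
  ... | yes a = σ a
  ... | no _  = Sign.+

  σ≡τ : ∀ {u v} (a : Adj u v) → σ a ≡ τ u v
  σ≡τ {u} {v} a with adj? u v
  ... | yes b = trans (σ-sym a (symm a)) (sym (σ-sym b (symm a)))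
  ... | no ¬a = contradiction a ¬a

  τ-sym : ∀ {u v} → Adj u v → τ u v ≡ τ v u
  τ-sym a = trans (sym (σ≡τ a)) (trans (σ-sym a (symm a)) (σ≡τ (symm a)))

  NegativeTriangle : Fin n → Fin n → Fin n → Set
  NegativeTriangle x y z = Adj x y × Adj y z × Adj x z × τ x y · τ y z ≢ τ x z

  negativeTriangle? : ∀ x y z → Dec (NegativeTriangle x y z)
  negativeTriangle? x y z =
    adj? x y ×-dec adj? y z ×-dec adj? x z ×-dec ¬? (τ x y · τ y z Sign.≟ τ x z)

  negativeClique⇒¬free : ∀ {K x y z} → AllPairs Adj K → x ∈ K → y ∈ K → z ∈ K →
                         NegativeTriangle x y z → ¬ 𝒦⁻-Free (length K) Γ
  negativeClique⇒¬free {K} clique x∈K y∈K z∈K (a , b , c , neg) free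
    -- Writing the three vertices as entries of `K` turns the triangle into one on positions, that
    -- is, a triangle of `Δ`.
    with i , refl ← ∈⇒lookup x∈K | j , refl ← ∈⇒lookup y∈K | l , refl ← ∈⇒lookup z∈K =
    free Δ (clique⇒complete Γ clique , unbalanced) (clique⇒⊑ Γ clique)
    where
    Δ : SignedGraph (length K)
    Δ = pullback Γ (lookup K)

    unbalanced : Unbalanced Δ
    unbalanced = negativeTriangle⇒unbalanced Δ {i} {j} {l} a b c λ eq →
      neg (trans (sym (cong₂ _·_ (σ≡τ a) (σ≡τ b))) (trans eq (σ≡τ c)))

  -- Counting edges along a spanning forest of the complement.

  edgesWithin : List (Fin n) → List (Fin n × Fin n)
  edgesWithin []       = []
  -- Each edge is listed at its newer end, so a new vertex contributes exactly its neighbours among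
  -- the earlier ones.
  edgesWithin (x ∷ xs) = map (orient x) (filter (adj? x) xs) ++ edgesWithin xs

  length-edgesWithin-∷ : ∀ x xs → length (edgesWithin (x ∷ xs)) ≡
                         length (filter (adj? x) xs) + length (edgesWithin xs)
  length-edgesWithin-∷ x xs = trans (length-++ (map _ (filter (adj? x) xs)))
    (cong (_+ length (edgesWithin xs)) (length-map _ (filter (adj? x) xs)))

  ∈-edgesWithin : ∀ {u v xs} → u ∈ xs → v ∈ xs → u < v → Adj u v → (u , v) ∈ edgesWithin xs
  ∈-edgesWithin (here refl) (here refl) _ a = contradiction a (irrefl refl)
  ∈-edgesWithin {u} {v} (here refl) (there v∈) u<v a = ∈-++⁺ˡ
    (subst (_∈ _) (orient-< u<v) (∈-map⁺ (orient u) (∈-filter⁺ (adj? u) v∈ a)))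
  ∈-edgesWithin {u} {v} (there u∈) (here refl) u<v a = ∈-++⁺ˡ
    (subst (_∈ _) (orient-> u<v) (∈-map⁺ (orient v) (∈-filter⁺ (adj? v) u∈ (symm a))))
  ∈-edgesWithin {xs = x ∷ xs} (there u∈) (there v∈) u<v a =
    ∈-++⁺ʳ (map _ (filter (adj? x) xs)) (∈-edgesWithin u∈ v∈ u<v a)

  e≤length-edgesWithin : ∀ {xs} → (∀ x → x ∈ xs) → e Γ ≤ length (edgesWithin xs)
  e≤length-edgesWithin all∈ = unique-⊆⇒length≤
    (filter⁺ edge? (cartesianProduct⁺ (allFin⁺ n) (allFin⁺ n)))
    λ {uv} uv∈ → let _ , u<v , a = ∈-filter⁻ edge? {v = uv} {xs = cartesianProduct (allFin n) (allFin n)} uv∈ in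
                 ∈-edgesWithin (all∈ _) (all∈ _) u<v a
    where
    edge? : Decidable λ (u , v) → (u < v) × Adj u v
    edge? (u , v) = (u <? v) ×-dec adj? u v

  -- The order in which a spanning forest of the complement of Γ is built, newest
  -- vertex first; a leaf hangs at some earlier vertex not adjacent to it in Γ.
  data Coforest : (roots verts : List (Fin n)) → Set where
    []   : Coforest [] []
    root : ∀ {v R L} → v ∉ L → Coforest R L → Coforest (v ∷ R) (v ∷ L)
    leaf : ∀ {v R L} → v ∉ L → ¬ All (Adj v) L → Coforest R L → Coforest R (v ∷ L)

  roots⊆verts : ∀ {R L} → Coforest R L → R ⊆ L
  roots⊆verts (root _ _)   (here eq)  = here eq
  roots⊆verts (root _ F)   (there v∈) = there (roots⊆verts F v∈)
  roots⊆verts (leaf _ _ F) v∈         = there (roots⊆verts F v∈)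

  unique-verts : ∀ {R L} → Coforest R L → Unique L
  unique-verts []            = []
  unique-verts (root v∉ F)   = ∉⇒unique v∉ (unique-verts F)
  unique-verts (leaf v∉ _ F) = ∉⇒unique v∉ (unique-verts F)

  -- |E(L)| ≤ |L|(|L| − 1)/2 − (|L| − |R|), rearranged to avoid subtraction and halving.
  coforest-bound : ∀ {R L} → Coforest R L →
    2 * length (edgesWithin L) + 3 * length L ≤ length L * length L + 2 * length R
  coforest-bound [] = z≤n
  coforest-bound (root {v} {R} {L} _ F) rewrite length-edgesWithin-∷ v L =
    ℕ.≤-trans (ℕ.≤-reflexive (lhs d E l)) (ℕ.≤-trans
      -- For a root only `d ≤ l` is known; the new entry of `R` adds 2 to the right side, which then
      -- grows by `2 * l + 3`.
      (ℕ.+-mono-≤ (coforest-bound F) (ℕ.+-monoˡ-≤ 3 (ℕ.*-monoʳ-≤ 2 (length-filter (adj? v) L))))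
      (ℕ.≤-reflexive (rhs l (length R))))
    where
    d = length (filter (adj? v) L)
    E = length (edgesWithin L)
    l = length L
    lhs : ∀ d E l → 2 * (d + E) + 3 * suc l ≡ (2 * E + 3 * l) + (2 * d + 3)
    lhs = solve-∀
    rhs : ∀ l ρ → (l * l + 2 * ρ) + (2 * l + 3) ≡ suc l * suc l + 2 * suc ρ
    rhs = solve-∀
  coforest-bound (leaf {v} {R} {L} _ ¬adj F) rewrite length-edgesWithin-∷ v L =
    ℕ.≤-trans (ℕ.≤-reflexive (lhs d E l)) (ℕ.≤-trans
      -- A leaf has an earlier non-neighbour, so `suc d ≤ l`; this gain of 2 replaces the
      -- contribution of a root.
      (ℕ.+-mono-≤ (coforest-bound F) (ℕ.+-monoˡ-≤ 1 (ℕ.*-monoʳ-≤ 2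
        (filter-notAll (adj? v) L (¬All⇒Any¬ (adj? v) L ¬adj)))))
      (ℕ.≤-reflexive (rhs l (length R))))
    where
    d = length (filter (adj? v) L)
    E = length (edgesWithin L)
    l = length L
    lhs : ∀ d E l → 2 * (d + E) + 3 * suc l ≡ (2 * E + 3 * l) + (2 * suc d + 1)
    lhs = solve-∀
    rhs : ∀ l ρ → (l * l + 2 * ρ) + (2 * l + 1) ≡ suc l * suc l + 2 * ρ
    rhs = solve-∀

  -- The bound is proved in doubled form. Division by 2 is monotone and splits off the even summand
  -- `length R * 2`, so it can be halved as it stands.
  spanning-bound : ∀ {R L} → Coforest R L → (∀ v → v ∈ L) →
                   e Γ + n ≤ (n * (n ∸ 1)) / 2 + length R
  spanning-bound {R} {L} F all∈ = begin
    e Γ + n                              ≡⟨ m*n/n≡m (e Γ + n) 2 ⟨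
    (e Γ + n) * 2 / 2                    ≤⟨ /-monoˡ-≤ 2 doubled ⟩
    (n * (n ∸ 1) + length R * 2) / 2     ≡⟨ +-distrib-/-∣ʳ (n * (n ∸ 1)) (n∣m*n (length R)) ⟩
    n * (n ∸ 1) / 2 + length R * 2 / 2   ≡⟨ cong (λ q → n * (n ∸ 1) / 2 + q) (m*n/n≡m (length R) 2) ⟩
    n * (n ∸ 1) / 2 + length R           ∎
    where
    open ℕ.≤-Reasoning
    length-L : length L ≡ n
    length-L = ℕ.≤-antisym (unique⇒length≤ (unique-verts F)) (covering⇒≤length all∈)

    n*n≡ : ∀ n → n * n ≡ n + n * (n ∸ 1)
    n*n≡ zero    = refl
    n*n≡ (suc m) = ℕ.*-suc (suc m) m

    lhs : ∀ E n → n + (E + n) * 2 ≡ 2 * E + 3 * n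
    lhs = solve-∀

    doubled : (e Γ + n) * 2 ≤ n * (n ∸ 1) + length R * 2
    -- Adding `n` completes `n * (n ∸ 1)` to the square `n * n` of `coforest-bound`.
    doubled = ℕ.+-cancelˡ-≤ n _ _ (begin
      n + (e Γ + n) * 2                        ≡⟨ lhs (e Γ) n ⟩
      2 * e Γ + 3 * n                          ≤⟨ ℕ.+-monoˡ-≤ (3 * n) (ℕ.*-monoʳ-≤ 2 (e≤length-edgesWithin all∈)) ⟩
      2 * length (edgesWithin L) + 3 * n       ≤⟨ subst (λ l → 2 * length (edgesWithin L) + 3 * l ≤ l * l + 2 * length R)
                                                        length-L (coforest-bound F) ⟩
      n * n + 2 * length R                     ≡⟨ cong₂ _+_ (n*n≡ n) (ℕ.*-comm 2 (length R)) ⟩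
      n + n * (n ∸ 1) + length R * 2           ≡⟨ ℕ.+-assoc n _ _ ⟩
      n + (n * (n ∸ 1) + length R * 2)         ∎)

  -- Growing a forest with an invariant on its roots; graphs with a negative triangle.

  span : (P : List (Fin n) → Set) → (∀ {v R} → P R → All (Adj v) R → P (v ∷ R)) →
         ∀ {R L} → Coforest R L → P R →
         ∃₂ λ R′ L′ → Coforest R′ L′ × P R′ × (∀ v → v ∈ L′)
  span P extend F PR =
    let R′ , L′ , F′ , PR′ , _ , all⊆ = go (allFin n) F PR
    in R′ , L′ , F′ , PR′ , λ v → all⊆ (∈-allFin v)
    where
    go : ∀ xs {R L} → Coforest R L → P R →
         ∃₂ λ R′ L′ → Coforest R′ L′ × P R′ × L ⊆ L′ × xs ⊆ L′
    add : ∀ x xs {R L} → x ∈ L → Coforest R L → P R →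
          ∃₂ λ R′ L′ → Coforest R′ L′ × P R′ × L ⊆ L′ × (x ∷ xs) ⊆ L′

    add x xs x∈L F PR with R′ , L′ , F′ , PR′ , L⊆ , xs⊆ ← go xs F PR =
      R′ , L′ , F′ , PR′ , L⊆ , λ { (here refl) → L⊆ x∈L ; (there y∈) → xs⊆ y∈ }

    go []       F PR = _ , _ , F , PR , id , λ ()
    go (x ∷ xs) {L = L} F PR with x ∈? L | all? (adj? x) L
    ... | yes x∈ | _ = add x xs x∈ F PR
    ... | no x∉  | no ¬adj
      with R′ , L′ , F′ , PR′ , L⊆ , xs⊆ ← add x xs (here refl) (leaf x∉ ¬adj F) PR =
      R′ , L′ , F′ , PR′ , L⊆ ∘ there , xs⊆
    ... | no x∉  | yes adj
      with R′ , L′ , F′ , PR′ , L⊆ , xs⊆ ← add x xs (here refl) (root x∉ F)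
             -- The new root is adjacent to all earlier vertices, in particular to the earlier
             -- roots.
             (extend PR (All.tabulate (All.lookup adj ∘ roots⊆verts F))) =
      R′ , L′ , F′ , PR′ , L⊆ ∘ there , xs⊆

  negativeTriangle⇒small-coforest : ∀ {x y z} → 2 ≤ r → 𝒦⁻-Free (suc r) Γ → NegativeTriangle x y z →
    ∃₂ λ R L → Coforest R L × length R ≤ r × (∀ v → v ∈ L)
  negativeTriangle⇒small-coforest {r} {x} {y} {z} 2≤r free T@(a , b , c , _) =
    let R , L , F , (_ , _ , R≤r) , all∈ = span SmallClique extend triangle start
    in R , L , F , R≤r , all∈
    where
    SmallClique : List (Fin n) → Set
    SmallClique K = AllPairs Adj K × (x ∷ y ∷ z ∷ []) ⊆ K × length K ≤ r

    -- A clique containing the negative triangle cannot have exactly `suc r` vertices, so the bound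
    -- `suc r` improves to `r`. This restores the invariant after each new root.
    small : ∀ {K} → AllPairs Adj K → (x ∷ y ∷ z ∷ []) ⊆ K → length K ≤ suc r → SmallClique K
    small {K} clique T⊆K K≤1+r = clique , T⊆K , ℕ.s≤s⁻¹ (ℕ.≤∧≢⇒< K≤1+r λ eq →
      negativeClique⇒¬free clique (T⊆K (here refl)) (T⊆K (there (here refl)))
        (T⊆K (there (there (here refl)))) T (subst (λ k → 𝒦⁻-Free k Γ) (sym eq) free))

    extend : ∀ {v K} → SmallClique K → All (Adj v) K → SmallClique (v ∷ K)
    extend (clique , T⊆K , K≤r) adj = small (adj ∷ clique) (there ∘ T⊆K) (s≤s K≤r)

    start : SmallClique (x ∷ y ∷ z ∷ [])
    -- `2 ≤ r` only gives `3 ≤ suc r`; `small` sharpens it to `3 ≤ r`.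
    start = small ((a ∷ c ∷ []) ∷ (b ∷ []) ∷ [] ∷ []) id (s≤s 2≤r)

    triangle : Coforest (x ∷ y ∷ z ∷ []) (x ∷ y ∷ z ∷ [])
    triangle = root (λ { (here eq) → irrefl eq a ; (there (here eq)) → irrefl eq c })
              (root (λ { (here eq) → irrefl eq b })
              (root (λ ()) []))

  -- Graphs without negative triangles.

  JoinedToRest : List (Fin n) → Set
  JoinedToRest L = ∀ {v} → v ∉ L → All (Adj v) L

  -- Only leaves are attached, until `L′` is a union of components of the complement. Fuel `n`
  -- suffices: a leaf still available at fuel zero would give more than `n` distinct vertices.
  saturate : ∀ {R L} → Coforest R L → ∃[ L′ ] Coforest R L′ × L ⊆ L′ × JoinedToRest L′
  saturate {L = L} F = go n F (ℕ.m≤m+n n (length L))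
    where
    go : ∀ fuel {R L} → Coforest R L → n ≤ fuel + length L →
         ∃[ L′ ] Coforest R L′ × L ⊆ L′ × JoinedToRest L′
    go fuel {L = L} F n≤ with any? (λ v → ¬? (v ∈? L) ×-dec ¬? (all? (adj? v) L))
    go fuel {L = L} F n≤ | no ¬leaf = L , F , id , λ {v} v∉ →
      decidable-stable (all? (adj? v) L) λ ¬adj → ¬leaf (v , v∉ , ¬adj)
    go zero       F n≤ | yes (v , v∉ , ¬adj) =
      contradiction (ℕ.≤-trans (unique⇒length≤ (∉⇒unique v∉ (unique-verts F))) n≤) (ℕ.<-irrefl refl)
    go (suc fuel) {L = L} F n≤ | yes (v , v∉ , ¬adj)
      with L′ , F′ , L⊆ , joined ← go fuel (leaf v∉ ¬adj F) (subst (n ≤_) (sym (ℕ.+-suc fuel (length L))) n≤) =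
      L′ , F′ , L⊆ ∘ there , joined

  module _ (no-neg : ∀ {x y z} → ¬ NegativeTriangle x y z) where

    triangle : ∀ {x y z} → Adj x y → Adj y z → Adj x z → τ x y · τ y z ≡ τ x z
    triangle a b c = decidable-stable (_ Sign.≟ _) λ neg → no-neg (a , b , c , neg)

    -- The three parts, pairwise joined, are `A`, `B` without `A`, and the vertices outside `B`,
    -- represented by `a`, `b` and `c`. The last two parts make the graph outside `A` connected,
    -- which is what `cross` exploits.
    join₃⇒balanced : ∀ {A B a b c} → A ⊆ B → JoinedToRest A → JoinedToRest B →
                     a ∈ A → b ∉ A → b ∈ B → c ∉ B → Balanced Γ
    join₃⇒balanced {A} {B} {a} {b} {c} A⊆B joinA joinB a∈A b∉A b∈B c∉B =
      switching⇒balanced Γ s λ uv → trans (σ≡τ uv) (τ≡ uv)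
      where
      s : Fin n → Sign
      -- Outside `A` every vertex is adjacent to `a`. A vertex of `A` need not be, so its sign is
      -- read off the path through `b` to `a`.
      s x = if does (x ∈? A) then τ x b · τ a b else τ a x

      _~_ : ∀ {x p} → x ∈ A → p ∉ A → Adj x p
      x∈A ~ p∉A = symm (All.lookup (joinA p∉A) x∈A)

      -- The triangles `x p q` and `a p q` share the edge `p q`, whose sign cancels. So
      -- `τ x y · τ a y` is constant as `y` moves along edges outside `A`.
      slide : ∀ {x p q} → x ∈ A → p ∉ A → q ∉ A → Adj p q → τ x q · τ a q ≡ τ x p · τ a p
      slide {x} {p} {q} x∈ p∉ q∉ pq = trans
        (sym (cong₂ _·_ (triangle (x∈ ~ p∉) pq (x∈ ~ q∉)) (triangle (a∈A ~ p∉) pq (a∈A ~ q∉))))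
        (·-cancelʳ (τ x p) (τ p q) (τ a p))

      -- y is adjacent to b or, inside B, to c, which is adjacent to b.
      cross : ∀ {x y} → x ∈ A → y ∉ A → τ x y · τ a y ≡ τ x b · τ a b
      cross {x} {y} x∈ y∉ with y ∈? B
      ... | yes y∈B = trans (slide x∈ c∉A y∉ (All.lookup (joinB c∉B) y∈B))
                            (slide x∈ b∉A c∉A (symm (All.lookup (joinB c∉B) b∈B)))
        where
        c∉A : c ∉ A
        c∉A = c∉B ∘ A⊆B
      ... | no y∉B = slide x∈ b∉A y∉ (symm (All.lookup (joinB y∉B) b∈B))

      τ-cross : ∀ {x y} → x ∈ A → y ∉ A → τ x y ≡ (τ x b · τ a b) · τ a y
      τ-cross {x} {y} x∈ y∉ = trans (sym (p·q·q≡p (τ x y) (τ a y))) (cong (_· τ a y) (cross x∈ y∉))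

      τ≡ : ∀ {x y} → Adj x y → τ x y ≡ s x · s y
      τ≡ {x} {y} xy with x ∈? A | y ∈? A
      -- Two vertices inside `A` form a triangle with `b`; two outside form one with `a`.
      ... | yes x∈ | yes y∈ = begin
        τ x y                               ≡⟨ triangle (x∈ ~ b∉A) (symm (y∈ ~ b∉A)) xy ⟨
        τ x b · τ b y                       ≡⟨ cong (τ x b ·_) (τ-sym (symm (y∈ ~ b∉A))) ⟩
        τ x b · τ y b                       ≡⟨ ·-cancelʳ (τ x b) (τ a b) (τ y b) ⟨
        (τ x b · τ a b) · (τ y b · τ a b)   ∎
        where open ≡-Reasoning
      ... | yes x∈ | no y∉  = τ-cross x∈ y∉
      ... | no x∉  | yes y∈ = trans (τ-sym xy) (trans (τ-cross y∈ x∉) (*-comm _ (τ a x)))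
      ... | no x∉  | no y∉  = trans (sym (triangle (symm (a∈A ~ x∉)) (a∈A ~ y∉) xy))
                                    (cong (_· τ a y) (τ-sym (symm (a∈A ~ x∉))))

    unbalanced⇒two-roots : Fin n → Unbalanced Γ →
      ∃₂ λ R L → Coforest R L × length R ≤ 2 × (∀ v → v ∈ L)
    unbalanced⇒two-roots a unbalanced
      with A , FA , a⊆A , joinA ← saturate (root {a} (λ ()) [])
      with covering-or-missing A
    ... | inj₁ all∈ = _ , A , FA , s≤s z≤n , all∈
    ... | inj₂ (b , b∉A)
      -- Since `b` starts a second root only after `A` is saturated, `A` is joined to everything
      -- outside it.
      with B , FB , bA⊆B , joinB ← saturate (root b∉A FA)
      with covering-or-missing B
    ...   | inj₁ all∈ = _ , B , FB , ℕ.≤-refl , all∈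
    ...   | inj₂ (c , c∉B) = ⊥-elim (unbalanced
      (join₃⇒balanced (bA⊆B ∘ there) joinA joinB (a⊆A (here refl)) b∉A (bA⊆B (here refl)) c∉B))

  -- Combining the two cases, and the bound over the integers.

  small-coforest : 2 ≤ r → 1 ≤ n → Unbalanced Γ → 𝒦⁻-Free (suc r) Γ →
                   ∃₂ λ R L → Coforest R L × length R ≤ r × (∀ v → v ∈ L)
  small-coforest 2≤r 1≤n unbalanced free
    with any? (λ x → any? λ y → any? λ z → negativeTriangle? x y z)
  ... | yes (_ , _ , _ , T) = negativeTriangle⇒small-coforest 2≤r free T
  ... | no none
    with R , L , F , R≤2 , all∈ ← unbalanced⇒two-roots (λ T → none (_ , _ , _ , T)) (fromℕ< 1≤n) unbalanced =
    R , L , F , ℕ.≤-trans R≤2 2≤r , all∈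

-- Subtraction is taken in the integers because `r`, in the place of `p`, may exceed `n`.
m+n≤o+p⇒m≤o-[n-p] : ∀ {m n o p} → m + n ≤ o + p → + m ≤ᶻ + o - (+ n - + p)
m+n≤o+p⇒m≤o-[n-p] {m} {n} {o} {p} le = begin
  + m                   ≡⟨ solve 2 (λ m n → m := m :+ n :- n) refl (+ m) (+ n) ⟩
  + (m + n) - + n       ≤⟨ ℤ.+-monoˡ-≤ (ℤ.- + n) (ℤ.+≤+ le) ⟩
  + (o + p) - + n       ≡⟨ solve 3 (λ n o p → o :+ p :- n := o :- (n :- p)) refl (+ n) (+ o) (+ p) ⟩
  + o - (+ n - + p)     ∎
  where
  open ℤ.≤-Reasoning
  open +-*-Solver

theorem1p7 : (r n : ℕ) → 2 ≤ r → 1 ≤ n →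
    (Γ : SignedGraph n) → Unbalanced Γ → 𝒦⁻-Free (suc r) Γ →
    (+ e Γ) ≤ᶻ (+ ((n * (n ∸ 1)) / 2)) - ((+ n) - (+ r))
theorem1p7 r n 2≤r 1≤n Γ unbalanced free
  with R , L , F , R≤r , all∈ ← small-coforest Γ 2≤r 1≤n unbalanced free =
  m+n≤o+p⇒m≤o-[n-p] {e Γ} {n} {(n * (n ∸ 1)) / 2} {r} (ℕ.≤-trans (spanning-bound Γ F all∈)
    (ℕ.+-monoʳ-≤ ((n * (n ∸ 1)) / 2) R≤r))
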